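{- Let $(\Lambda,\to_{p})$ be a pure calculus and $(\Lambda^X,\to)$ a calculus with explicit substitutions with $\Lambda\subset\Lambda^X$. Let $T$ be a typing system for the pure calculus and $T'$ a typing system for the calculus with explicit substitutions, and assume that every pure term typable with respect to $T$ is strongly normalizing in the pure calculus. Suppose that there exists a function $\mathit{Ateb}:\Lambda^X\to\Lambda$ such that: (Preservation of typability) for every $t\in\Lambda^X$ typable with respect to $T'$, the pure term $\mathit{Ateb}(t)$ is typable with respect to $T$ in the pure calculus; (Initialization) $\mathit{Ateb}(t)$ reduces to $t$ in zero or more steps of $\to$. Then PSN implies SN with respect to $T'$. That is, if every pure term that is strongly normalizing for $\to_p$ is strongly normalizing for $\to$, then every term of $\Lambda^X$ typable with respect to $T'$ is strongly normalizing for $\to$.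
   Context: A calculus is a set of terms with a reduction relation. A pure calculus $(\Lambda,\to_p)$ has no explicit substitutions. A calculus with explicit substitutions $(\Lambda^X,\to)$ has as terms a set $\Lambda^X$ containing the pure terms $\Lambda$. A typing system singles out a subset of typable terms. A term is strongly normalizing for a reduction relation if there is no infinite reduction sequence starting from it. PSN (preservation of strong normalization): every pure term strongly normalizing in the pure calculus is strongly normalizing in the calculus with explicit substitutions. SN (with respect to a typing system): every typable term is strongly normalizing in the calculus with explicit substitutions. -}

module Defs where

open import Data.Product using (∃-syntax)
open import Function.Base using (flip)
open import Function.Bundles using (_↣_; module Injection)
open import Induction.InfiniteDescent using (InfiniteDescendingSequenceFrom)
open import Level using (Level; _⊔_; suc)
open import Relation.Binary.Construct.Closure.ReflexiveTransitive using (Star)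
open import Relation.Binary.Core using (Rel)
open import Relation.Nullary.Negation using (¬_)
open import Relation.Unary using (Pred; _∈_)

private
  variable
    c r c′ r′ ℓ ℓ′ : Level

record Calculus (c r : Level) : Set (suc (c ⊔ r)) where
  infix 4 _⟶_ _⟶*_
  field
    Term : Set c
    _⟶_  : Rel Term r

  _⟶*_ : Rel Term (c ⊔ r)
  _⟶*_ = Star _⟶_

  -- The library's strong normalization is accessibility (`Acc`), which is
  -- constructively stronger than the absence of infinite reductions meant here.
  StronglyNormalizing : Pred Term (c ⊔ r)
  StronglyNormalizing t = ¬ (∃[ f ] InfiniteDescendingSequenceFrom (flip _⟶_) f t)

open Calculus

-- Only the set of typable terms of a typing system is relevant.
TypingSystem : Calculus c r → (ℓ : Level) → Set (c ⊔ suc ℓ)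
TypingSystem C ℓ = Pred (Term C) ℓ

TypableTermsSN : (C : Calculus c r) → TypingSystem C ℓ → Set (c ⊔ r ⊔ ℓ)
TypableTermsSN C T = ∀ t → t ∈ T → StronglyNormalizing C t

-- The inclusion Λ ⊂ Λˣ is an injection between the types of terms; it is not
-- assumed to relate the two reduction relations.
module _ (Λ : Calculus c r) (Λˣ : Calculus c′ r′) (incl : Term Λ ↣ Term Λˣ) where

  private
    ⌜_⌝ : Term Λ → Term Λˣ
    ⌜_⌝ = Injection.to incl

  PSN : Set (c ⊔ r ⊔ c′ ⊔ r′)
  PSN = ∀ t → StronglyNormalizing Λ t → StronglyNormalizing Λˣ ⌜ t ⌝

  Initialization : (Term Λˣ → Term Λ) → Set (c′ ⊔ r′)
  Initialization Ateb = ∀ t → _⟶*_ Λˣ ⌜ Ateb t ⌝ t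

PreservesTypability : (Λ : Calculus c r) (Λˣ : Calculus c′ r′) →
                      TypingSystem Λ ℓ → TypingSystem Λˣ ℓ′ →
                      (Term Λˣ → Term Λ) → Set (c′ ⊔ ℓ ⊔ ℓ′)
PreservesTypability Λ Λˣ T T′ Ateb = ∀ t → t ∈ T′ → Ateb t ∈ T

{-# OPTIONS --safe #-}
module Submission where

open import Defs
open import Data.Nat.Base using (zero; suc)
open import Data.Product using (_×_; _,_; ∃-syntax)
open import Function.Base using (_∘_)
open import Function.Bundles using (_↣_)
open import Level using (Level)
open import Relation.Binary.Construct.Closure.ReflexiveTransitive using (ε; _◅_)
open import Relation.Binary.PropositionalEquality using (refl)

-- Strong normalization passes to reducts (`SN-steps`), and by initialization each `t` is a reduct
-- of the image of the pure term `Ateb t`. For typable `t`, `Ateb t` is typable in `T`, hence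
-- strongly normalizing in the pure calculus; PSN carries this over to its image, and so `t`
-- inherits it.

module _ {c r : Level} (C : Calculus c r) where
  open Calculus C

  -- An infinite reduction `f` from `t` becomes one from `s` by putting `s` in front. Matching on
  -- `refl` turns `t` into `f zero`, so `s⟶t` is exactly the new first step.
  SN-step : ∀ {s t} → s ⟶ t → StronglyNormalizing s → StronglyNormalizing t
  SN-step {s} s⟶t sn (f , refl , steps) =
    sn ( (λ { zero → s ; (suc n) → f n })
       , refl
       , (λ { zero → s⟶t ; (suc n) → steps n }))

  SN-steps : ∀ {s t} → s ⟶* t → StronglyNormalizing s → StronglyNormalizing t
  SN-steps ε = λ sn → sn
  SN-steps (s⟶u ◅ u⟶*t) = SN-steps u⟶*t ∘ SN-step s⟶u

theorem2p3 : ∀ {c r c′ r′ ℓ ℓ′ : Level}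
    (Λ : Calculus c r) (Λˣ : Calculus c′ r′)
    (incl : Calculus.Term Λ ↣ Calculus.Term Λˣ)
    (T : TypingSystem Λ ℓ) (T′ : TypingSystem Λˣ ℓ′) →
    TypableTermsSN Λ T →
    (∃[ Ateb ] (PreservesTypability Λ Λˣ T T′ Ateb × Initialization Λ Λˣ incl Ateb)) →
    PSN Λ Λˣ incl →
    TypableTermsSN Λˣ T′
theorem2p3 Λ Λˣ incl T T′ typable-SN (Ateb , preserves , init) psn t t∈T′ =
  SN-steps Λˣ (init t) (psn (Ateb t) (typable-SN (Ateb t) (preserves t t∈T′)))
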